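{- Let $\lambda$ be a nonzero real number, $p\ge-1$ an integer and $x\in\mathbb{R}$. For every integer $n\ge 0$, $$\beta_{n,\lambda}^{(p)}(x)=\sum_{k=0}^{n}\frac{(1)_{k+1,1/\lambda}\,\lambda^{k}}{\binom{p+k+1}{p+1}}\,S_{2,\lambda}(n,k|x).$$
   Context: For real $\mu$ and $x$: $(x)_{0,\mu}=1$ and $(x)_{n,\mu}=x(x-\mu)(x-2\mu)\cdots(x-(n-1)\mu)$ for $n\ge 1$; thus $(1)_{k+1,1/\lambda}$ is this symbol with $x=1$, $\mu=1/\lambda$. Also $\langle a\rangle_0=1$, $\langle a\rangle_k=a(a+1)\cdots(a+k-1)$ for $k\ge1$. The degenerate exponential is the formal power series $e_\lambda^x(t)=\sum_{n\ge0}(x)_{n,\lambda}\frac{t^n}{n!}$, with $e_\lambda(t)=e_\lambda^1(t)$. The degenerate Stirling polynomials of the second kind $S_{2,\lambda}(n,k|x)$ are defined, for $k\ge0$, by $\frac{1}{k!}(e_\lambda(t)-1)^k e_\lambda^x(t)=\sum_{n\ge k}S_{2,\lambda}(n,k|x)\frac{t^n}{n!}$. The Gauss hypergeometric series is ${}_2F_1(a,b;c;z)=\sum_{k\ge0}\frac{\langle a\rangle_k\langle b\rangle_k}{\langle c\rangle_k}\frac{z^k}{k!}$. For an integer $p\ge-1$, the generalized degenerate Bernoulli polynomials $\beta_{n,\lambda}^{(p)}(x)$ ($n\ge0$) are defined by the identity of formal power series in $t$ $${}_2F_1\big(1-\lambda,1;p+2;1-e_\lambda(t)\big)\,e_\lambda^x(t)=\sum_{n=0}^\infty\beta_{n,\lambda}^{(p)}(x)\frac{t^n}{n!}.$$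 -}

module Defs where

open import Algebra.Apartness.Bundles using (HeytingCommutativeRing; HeytingField)
open import Algebra.Bundles using (CommutativeRing)
import Algebra.Apartness.Properties.HeytingCommutativeRing as HeytingProperties
import Algebra.Properties.Monoid.Mult as MonoidMult
import Algebra.Properties.Monoid.Sum as MonoidSum
import Algebra.Properties.Semiring.Exp as SemiringExp
open import Data.Fin.Base using (toℕ)
import Data.Integer.Base as ℤ
open ℤ using (ℤ; +_; -[1+_]; ∣_∣)
import Data.Integer.Properties as ℤ
import Data.Nat.Base as ℕ
open ℕ using (ℕ; zero; suc; NonZero; _!; z≤n; s≤s)
open import Data.Nat.Combinatorics using (_C_; nCk+nC[k+1]≡[n+1]C[k+1]; nCk≡nC[n∸k]; nCn≡1)
import Data.Nat.Properties as ℕ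
open import Data.Product.Base using (proj₁; proj₂; ∃-syntax; _,_)
open import Relation.Binary.PropositionalEquality as ≡ using (_≡_)

nCk≢0 : ∀ {n k} → k ℕ.≤ n → NonZero (n C k)
nCk≢0 {n} z≤n rewrite nCk≡nC[n∸k] {0} {n} z≤n | nCn≡1 n = _
nCk≢0 (s≤s {k} {n} k≤n) =
  ≡.subst NonZero (nCk+nC[k+1]≡[n+1]C[k+1] n k)
    (ℕ.>-nonZero (ℕ.≤-trans (ℕ.>-nonZero⁻¹ (n C k) {{nCk≢0 k≤n}}) (ℕ.m≤m+n _ _)))

p+2-positive : ∀ p → ℤ.-1ℤ ℤ.≤ p → ∃[ m ] p ℤ.+ + 2 ≡ + suc m
p+2-positive (+ n)      _ = n ℕ.+ 1 , ≡.cong +_ (ℕ.+-suc n 1)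
p+2-positive -[1+ zero ]  _ = 0 , ≡.refl
p+2-positive -[1+ suc _ ] (ℤ.-≤- ())

p+1≤p+k+1 : ∀ p → ℤ.-1ℤ ℤ.≤ p → ∀ k → ∣ p ℤ.+ + 1 ∣ ℕ.≤ ∣ p ℤ.+ + k ℤ.+ + 1 ∣
p+1≤p+k+1 (+ n)      _ k = ℕ.+-monoˡ-≤ 1 (ℕ.m≤m+n n k)
p+1≤p+k+1 -[1+ zero ]  _ k = z≤n
p+1≤p+k+1 -[1+ suc _ ] (ℤ.-≤- ())

module _ {c ℓ₁ ℓ₂} (F : HeytingField c ℓ₁ ℓ₂) where
  open HeytingField F
  open HeytingCommutativeRing heytingCommutativeRing using (commutativeRing)
  open MonoidMult (CommutativeRing.+-monoid commutativeRing) using (_×_)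

  CharacteristicZero : Set ℓ₂
  CharacteristicZero = ∀ n → suc n × 1# # 0#

module Degenerate
  {c ℓ₁ ℓ₂} (F : HeytingField c ℓ₁ ℓ₂) (char0 : CharacteristicZero F)
  where

  open HeytingField F
  open HeytingCommutativeRing heytingCommutativeRing using (commutativeRing)
  open CommutativeRing commutativeRing using (semiring; +-monoid)
  open HeytingProperties heytingCommutativeRing
  open MonoidMult +-monoid using (×-homo-+)
  open MonoidMult +-monoid public using (_×_)
  open SemiringExp semiring public using (_^_)
  open MonoidSum +-monoid public using (sum-syntax; sum⁺-syntax)
  open import Relation.Binary.Reasoning.Setoid setoid

  infixl 7 _/_[_]

  _/_[_] : (x y : Carrier) → y # 0# → Carrier
  x / y [ y#0 ] = x * proj₁ (#⇒invertible y#0)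

  fromℤ : ℤ → Carrier
  fromℤ (+ n)    = n × 1#
  fromℤ -[1+ n ] = - (suc n × 1#)

  nonZero⇒#0 : ∀ n → .{{NonZero n}} → n × 1# # 0#
  nonZero⇒#0 (suc n) = char0 n

  infixl 7 _/!_

  _/!_ : Carrier → ℕ → Carrier
  x /! n = x / ((n !) × 1#) [ nonZero⇒#0 (n !) {{n ℕ.!≢0}} ]

  -- (x)_{n,μ}
  falling : Carrier → ℕ → Carrier → Carrier
  falling x zero    μ = 1#
  falling x (suc n) μ = falling x n μ * (x - n × μ)

  ⟨_⟩_ : Carrier → ℕ → Carrier
  ⟨ a ⟩ zero  = 1#
  ⟨ a ⟩ suc k = (⟨ a ⟩ k) * (a + k × 1#)

  -- f stands for the formal power series Σ f n tⁿ (ordinary coefficients).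
  Series : Set c
  Series = ℕ → Carrier

  infix  4 _≋_
  infixl 6 _-ˢ_
  infixl 7 _*ˢ_
  infixr 8 _^ˢ_

  _≋_ : Series → Series → Set ℓ₁
  f ≋ g = ∀ n → f n ≈ g n

  1ˢ : Series
  1ˢ zero    = 1#
  1ˢ (suc n) = 0#

  _-ˢ_ : Series → Series → Series
  (f -ˢ g) n = f n - g n

  _*ˢ_ : Series → Series → Series
  (f *ˢ g) n = ∑[ i ≤ n ] (f (toℕ i) * g (n ℕ.∸ toℕ i))

  _^ˢ_ : Series → ℕ → Series
  f ^ˢ zero  = 1ˢ
  f ^ˢ suc k = f *ˢ f ^ˢ k

  -- f(g(t)) = Σ_k f k · g(t)^k.  As g has no constant term, g^k starts in
  -- degree k, so the terms with k > n do not contribute to the coefficient of tⁿ.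
  substitute : (f g : Series) → g 0 ≈ 0# → Series
  substitute f g _ n = ∑[ k ≤ n ] (f (toℕ k) * (g ^ˢ toℕ k) n)

  -- Σ a n tⁿ/n!
  egf : (ℕ → Carrier) → Series
  egf a n = a n /! n

  -- The unique a with egf a ≋ f.
  egfCoefficients : Series → ℕ → Carrier
  egfCoefficients f n = ((n !) × 1#) * f n

  egf-egfCoefficients : ∀ f → egf (egfCoefficients f) ≋ f
  egf-egfCoefficients f n = begin
    N * f n * N⁻¹    ≈⟨ *-congʳ (*-comm N (f n)) ⟩
    f n * N * N⁻¹    ≈⟨ *-assoc (f n) N N⁻¹ ⟩
    f n * (N * N⁻¹)  ≈⟨ *-congˡ (*-congʳ (x-0≈x N)) ⟨
    f n * ((N - 0#) * N⁻¹) ≈⟨ *-congˡ (proj₂ (proj₂ inv)) ⟩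
    f n * 1#         ≈⟨ *-identityʳ (f n) ⟩
    f n              ∎
    where
    N   = (n !) × 1#
    inv = #⇒invertible (nonZero⇒#0 (n !) {{n ℕ.!≢0}})
    N⁻¹ = proj₁ inv

  -- e_λ^x(t)
  e : Carrier → Carrier → Series
  e lam x = egf (λ n → falling x n lam)

  -- S_{2,λ}(n,k|x)
  S₂ : Carrier → ℕ → ℕ → Carrier → Carrier
  S₂ lam n k x =
    egfCoefficients (λ m → ((e lam 1# -ˢ 1ˢ) ^ˢ k *ˢ e lam x) m /! k) n

  -- The power series ₂F₁(a,b;c;z) in z.
  ₂F₁ : (a b c : Carrier) → (∀ k → ⟨ c ⟩ k # 0#) → Series
  ₂F₁ a b c ⟨c⟩#0 k = (⟨ a ⟩ k) * (⟨ b ⟩ k) / (⟨ c ⟩ k) [ ⟨c⟩#0 k ] /! k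

  1-e-constant : ∀ lam x → (1ˢ -ˢ e lam x) 0 ≈ 0#
  1-e-constant lam x = begin
    1# - 1# /! 0  ≈⟨ +-congˡ (-‿cong 1/!0≈1) ⟩
    1# - 1#       ≈⟨ -‿inverseʳ 1# ⟩
    0#            ∎
    where
    1/!0≈1 : 1# /! 0 ≈ 1#
    1/!0≈1 = trans (*-congʳ (sym (trans (*-identityʳ _) (+-identityʳ 1#))))
                   (egf-egfCoefficients (λ _ → 1#) 0)

  ⟨m+1⟩#0 : ∀ m k → ⟨ suc m × 1# ⟩ k # 0#
  ⟨m+1⟩#0 m zero    = 1#0
  ⟨m+1⟩#0 m (suc k) =
    x#0y#0→xy#0 (⟨m+1⟩#0 m k) (#-congʳ (×-homo-+ 1# (suc m) k) (char0 (m ℕ.+ k)))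

  ⟨p+2⟩#0 : ∀ p → ℤ.-1ℤ ℤ.≤ p → ∀ k → ⟨ fromℤ (p ℤ.+ + 2) ⟩ k # 0#
  ⟨p+2⟩#0 p -1≤p k with p+2-positive p -1≤p
  ... | m , eq rewrite eq = ⟨m+1⟩#0 m k

  -- β_{n,λ}^{(p)}(x)
  β : (p : ℤ) → ℤ.-1ℤ ℤ.≤ p → Carrier → ℕ → Carrier → Carrier
  β p -1≤p lam n x =
    egfCoefficients
      (substitute
         (₂F₁ (1# - lam) 1# (fromℤ (p ℤ.+ + 2)) (⟨p+2⟩#0 p -1≤p))
         (1ˢ -ˢ e lam 1#) (1-e-constant lam 1#)
       *ˢ e lam x)
      n

  -- The binomial coefficient (p+k+1 choose p+1); for p ≥ -1 both entries are
  -- nonnegative, so taking absolute values only changes their type to ℕ.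
  binomial : ℤ → ℕ → Carrier
  binomial p k = (∣ p ℤ.+ + k ℤ.+ + 1 ∣ C ∣ p ℤ.+ + 1 ∣) × 1#

  binomial#0 : ∀ p → ℤ.-1ℤ ℤ.≤ p → ∀ k → binomial p k # 0#
  binomial#0 p -1≤p k = nonZero⇒#0 _ {{nCk≢0 (p+1≤p+k+1 p -1≤p k)}}

{-# OPTIONS --safe #-}

-- With h = e_λ^x(t), substituting 1 - e_λ(t) into
-- Σ f_k z^k and multiplying by h gives Σ f_k (1 - e_λ(t))^k h, where only k ≤ n
-- matters for the coefficient of tⁿ.  Extracting (-1)^k from (1 - e_λ(t))^k turns
-- the k-th summand into a multiple of S₂ lam n k x, and the coefficients agree because
-- (1)_{k+1,1/λ} λ^k = (λ-1)⋯(λ-k) = (-1)^k ⟨1-λ⟩_k and, with m = p + 1,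
-- ⟨1⟩_k / ⟨m+1⟩_k = k! m! / (m+k)! = 1 / binom(m+k, m).

module Submission where

open import Defs
open import Algebra.Apartness.Bundles using (HeytingCommutativeRing; HeytingField)
import Algebra.Apartness.Properties.HeytingCommutativeRing as HeytingProperties
open import Algebra.Bundles using (CommutativeRing)
import Algebra.Properties.AbelianGroup as AbelianGroupProperties
import Algebra.Properties.CommutativeSemigroup as CommutativeSemigroupProperties
import Algebra.Properties.Ring as RingProperties
import Algebra.Properties.Semiring.Mult as SemiringMult
import Algebra.Properties.Semiring.Sum as SemiringSum
import Algebra.Solver.CommutativeMonoid as CommutativeMonoidSolver
open import Data.Fin.Base using (Fin; zero; suc; toℕ)
import Data.Fin.Properties as Fin
open import Data.Integer.Base using (ℤ; -1ℤ; +_; -[1+_]; ∣_∣; -≤-) renaming (_≤_ to _≤ℤ_)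
import Data.Integer.Base as ℤ
open import Data.Nat.Base using (ℕ; zero; suc; z≤n; s≤s; _!)
import Data.Nat.Base as ℕ
open import Data.Nat.Combinatorics using (_C_; nCk≡n!/k![n-k]!; k![n∸k]!∣n!)
open import Data.Nat.DivMod using (m/n*n≡m)
import Data.Nat.Properties as ℕ
open import Data.Product.Base using (proj₁; proj₂)
open import Function.Base using (_∘_)
open import Relation.Binary.PropositionalEquality.Core as ≡ using (_≡_)
import Relation.Binary.Reasoning.Setoid as SetoidReasoning

-- Binomial coefficients over the natural numbers.

-- The factorial formula for `_C_` is a truncated quotient, exact here because the denominator
-- divides `(m + k) !`. The `subst` turns `m + k ∸ m` into `k`.
[m+k]Cm*[m!*k!]≡[m+k]! : ∀ m k → ((m ℕ.+ k) C m) ℕ.* (m ! ℕ.* k !) ≡ (m ℕ.+ k) !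
[m+k]Cm*[m!*k!]≡[m+k]! m k =
  ≡.subst (λ j → ((m ℕ.+ k) C m) ℕ.* (m ! ℕ.* j !) ≡ (m ℕ.+ k) !) (ℕ.m+n∸m≡n m k)
    (≡.trans (≡.cong (ℕ._* (m ! ℕ.* (m ℕ.+ k ℕ.∸ m) !)) (nCk≡n!/k![n-k]! m≤m+k))
             (m/n*n≡m {{m ℕ.!* (m ℕ.+ k ℕ.∸ m) !≢0}} (k![n∸k]!∣n! m≤m+k)))
  where
  m≤m+k = ℕ.m≤m+n m k

-- Brings the upper entry of `binomial p k` into the form `m + k` with `m = ∣ p + 1 ∣`; here
-- `p = -1` gives `m = 0`.
∣p+k+1∣≡∣p+1∣+k : ∀ p → -1ℤ ≤ℤ p → ∀ k →
                  ∣ p ℤ.+ + k ℤ.+ + 1 ∣ ≡ ∣ p ℤ.+ + 1 ∣ ℕ.+ k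
∣p+k+1∣≡∣p+1∣+k (+ q) _ k =
  ≡.trans (ℕ.+-assoc q k 1) (≡.trans (≡.cong (q ℕ.+_) (ℕ.+-comm k 1)) (≡.sym (ℕ.+-assoc q 1 k)))
∣p+k+1∣≡∣p+1∣+k -[1+ zero ]  _ zero    = ≡.refl
∣p+k+1∣≡∣p+1∣+k -[1+ zero ]  _ (suc k) = ℕ.+-comm k 1
∣p+k+1∣≡∣p+1∣+k -[1+ suc _ ] (-≤- ())

module _ {c ℓ₁ ℓ₂} (F : HeytingField c ℓ₁ ℓ₂) (char0 : CharacteristicZero F) where
  open HeytingField F
  open Degenerate F char0
  open HeytingCommutativeRing heytingCommutativeRing using (commutativeRing)
  open HeytingProperties heytingCommutativeRing using (x-0≈x)
  open CommutativeRing commutativeRing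
    using (ring; semiring; +-abelianGroup; +-commutativeSemigroup; *-commutativeMonoid)
  open AbelianGroupProperties +-abelianGroup using () renaming (⁻¹-anti-homo‿- to -‿anti-homo‿-)
  open CommutativeSemigroupProperties +-commutativeSemigroup using (xy∙z≈xz∙y)
  open RingProperties ring using (-1*x≈-x; [y-z]x≈yx-zx)
  open SemiringMult semiring using (×-homo-+; ×-congʳ; ×-assoc-*; ×1-homo-*)
  open SemiringSum semiring
    using (sum; sum-cong-≋; sum-replicate-zero; ∑-comm; *-distribˡ-sum; *-distribʳ-sum)
  open CommutativeMonoidSolver *-commutativeMonoid using (solve; _⊕_; _⊜_)
  open SetoidReasoning setoid

  -- Division in a Heyting field.

  *-inverseʳ : ∀ {y} (y#0 : y # 0#) → y * proj₁ (#⇒invertible y#0) ≈ 1#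
  *-inverseʳ {y} y#0 =
    -- `#⇒invertible` inverts the difference `y - 0#`, not `y` itself.
    trans (*-congʳ (sym (x-0≈x y))) (proj₂ (proj₂ (#⇒invertible y#0)))

  *-cancelʳ-# : ∀ {x y z} → z # 0# → x * z ≈ y * z → x ≈ y
  *-cancelʳ-# {x} {y} {z} z#0 xz≈yz = begin
    x               ≈⟨ x≈xzz⁻¹ x ⟩
    x * z * z⁻¹     ≈⟨ *-congʳ xz≈yz ⟩
    y * z * z⁻¹     ≈⟨ x≈xzz⁻¹ y ⟨
    y               ∎
    where
    z⁻¹ = proj₁ (#⇒invertible z#0)
    x≈xzz⁻¹ : ∀ w → w ≈ w * z * z⁻¹
    x≈xzz⁻¹ w = sym (trans (*-assoc w z z⁻¹) (trans (*-congˡ (*-inverseʳ z#0)) (*-identityʳ w)))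

  cross-multiply : ∀ {w x y z} (y#0 : y # 0#) (z#0 : z # 0#) →
                   w * z ≈ x * y → w / y [ y#0 ] ≈ x / z [ z#0 ]
  cross-multiply {w} {x} {y} {z} y#0 z#0 wz≈xy = begin
    w * y⁻¹              ≈⟨ *-identityʳ _ ⟨
    w * y⁻¹ * 1#         ≈⟨ *-congˡ (*-inverseʳ z#0) ⟨
    w * y⁻¹ * (z * z⁻¹)  ≈⟨ solve 4 (λ a b c d → (a ⊕ b) ⊕ (c ⊕ d) ⊜ ((a ⊕ c) ⊕ b) ⊕ d) refl w y⁻¹ z z⁻¹ ⟩
    w * z * y⁻¹ * z⁻¹    ≈⟨ *-congʳ (*-congʳ wz≈xy) ⟩
    x * y * y⁻¹ * z⁻¹    ≈⟨ *-congʳ (*-assoc x y y⁻¹) ⟩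
    x * (y * y⁻¹) * z⁻¹  ≈⟨ *-congʳ (*-congˡ (*-inverseʳ y#0)) ⟩
    x * 1# * z⁻¹         ≈⟨ *-congʳ (*-identityʳ x) ⟩
    x * z⁻¹              ∎
    where
    y⁻¹ = proj₁ (#⇒invertible y#0)
    z⁻¹ = proj₁ (#⇒invertible z#0)

  -- Finite sums and formal power series.

  sum-zero : ∀ {n} {f : Fin n → Carrier} → (∀ i → f i ≈ 0#) → sum f ≈ 0#
  sum-zero {n} f≈0 = trans (sum-cong-≋ f≈0) (sum-replicate-zero n)

  sum-extend : ∀ (f : ℕ → Carrier) {m n} → m ℕ.≤ n → (∀ k → m ℕ.≤ k → f k ≈ 0#) →
               ∑[ k < m ] f (toℕ k) ≈ ∑[ k < n ] f (toℕ k)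
  sum-extend f {n = n} z≤n f≈0 = sym (sum-zero {n} (λ k → f≈0 (toℕ k) z≤n))
  sum-extend f (s≤s m≤n) f≈0 =
    +-congˡ (sum-extend (f ∘ suc) m≤n (λ k m≤k → f≈0 (suc k) (s≤s m≤k)))

  -- In the product `g *ˢ g ^ˢ k`, the term `j = 0` contains `g 0`, and every later term contains a
  -- coefficient of `g ^ˢ k` of degree below `k`, which vanishes by induction.
  ^ˢ-order : ∀ {g} → g 0 ≈ 0# → ∀ k i → i ℕ.< k → (g ^ˢ k) i ≈ 0#
  ^ˢ-order {g} g₀≈0 (suc k) i (s≤s i≤k) = sum-zero (term≈0 i i≤k)
    where
    -- The degree is quantified afresh so that the case `suc j` can split it as `suc i`, making the
    -- remaining degree `i ∸ toℕ j`, at most `i` and hence below `k`.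
    term≈0 : ∀ i → i ℕ.≤ k → (j : Fin (suc i)) → g (toℕ j) * (g ^ˢ k) (i ℕ.∸ toℕ j) ≈ 0#
    term≈0 i       i≤k zero    = trans (*-congʳ g₀≈0) (zeroˡ _)
    term≈0 (suc i) i<k (suc j) =
      trans (*-congˡ (^ˢ-order g₀≈0 k (i ℕ.∸ toℕ j) (ℕ.≤-<-trans (ℕ.m∸n≤m i (toℕ j)) i<k)))
            (zeroʳ _)

  *ˢ-scaleˡ : ∀ a f g n → ((λ i → a * f i) *ˢ g) n ≈ a * (f *ˢ g) n
  *ˢ-scaleˡ a f g n =
    trans (sum-cong-≋ {suc n} (λ i → *-assoc a (f (toℕ i)) (g (n ℕ.∸ toℕ i))))
          (sym (*-distribˡ-sum {suc n} a (λ i → f (toℕ i) * g (n ℕ.∸ toℕ i))))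

  *ˢ-congʳ : ∀ {f f′} g → f ≋ f′ → f *ˢ g ≋ f′ *ˢ g
  *ˢ-congʳ g f≋f′ n = sum-cong-≋ {suc n} (λ i → *-congʳ {g (n ℕ.∸ toℕ i)} (f≋f′ (toℕ i)))

  -- Each factor contributes one `- 1#`. This passes from the powers of `1ˢ -ˢ e` in `β` to those of
  -- `e -ˢ 1ˢ` in `S₂`.
  -ˢ-^ˢ : ∀ f g k i → ((f -ˢ g) ^ˢ k) i ≈ (- 1#) ^ k * ((g -ˢ f) ^ˢ k) i
  -ˢ-^ˢ f g zero    i = sym (*-identityˡ _)
  -ˢ-^ˢ f g (suc k) i = begin
    ∑[ j ≤ i ] (u (toℕ j) * (u ^ˢ k) (i ℕ.∸ toℕ j))
      ≈⟨ sum-cong-≋ {suc i} (λ j → *-cong (u≈-1*v (toℕ j)) (-ˢ-^ˢ f g k (i ℕ.∸ toℕ j))) ⟩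
    ∑[ j ≤ i ] (- 1# * v (toℕ j) * ((- 1#) ^ k * (v ^ˢ k) (i ℕ.∸ toℕ j)))
      ≈⟨ sum-cong-≋ {suc i} (λ j → solve 4 (λ a b c d → (a ⊕ b) ⊕ (c ⊕ d) ⊜ (a ⊕ c) ⊕ (b ⊕ d)) refl
           (- 1#) (v (toℕ j)) ((- 1#) ^ k) ((v ^ˢ k) (i ℕ.∸ toℕ j))) ⟩
    ∑[ j ≤ i ] ((- 1#) ^ suc k * (v (toℕ j) * (v ^ˢ k) (i ℕ.∸ toℕ j)))
      ≈⟨ *-distribˡ-sum {suc i} ((- 1#) ^ suc k) (λ j → v (toℕ j) * (v ^ˢ k) (i ℕ.∸ toℕ j)) ⟨
    (- 1#) ^ suc k * (v ^ˢ suc k) i ∎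
    where
    u = f -ˢ g
    v = g -ˢ f
    u≈-1*v : ∀ j → u j ≈ - 1# * v j
    u≈-1*v j = sym (trans (-1*x≈-x (v j)) (-‿anti-homo‿- (g j) (f j)))

  -- The inner sum of `substitute` stops at the outer index `i`. Extending it to `n` by vanishing
  -- terms makes the double sum rectangular, so the two summations commute.
  substitute-*ˢ : ∀ f g (g₀≈0 : g 0 ≈ 0#) h n →
    (substitute f g g₀≈0 *ˢ h) n ≈ ∑[ k ≤ n ] (f (toℕ k) * (g ^ˢ toℕ k *ˢ h) n)
  substitute-*ˢ f g g₀≈0 h n = begin
    ∑[ i ≤ n ] (substitute f g g₀≈0 (toℕ i) * hᵢ i)
      ≈⟨ sum-cong-≋ {suc n} (λ i → *-congʳ {hᵢ i} (extend i)) ⟩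
    ∑[ i ≤ n ] (∑[ k ≤ n ] (f (toℕ k) * (g ^ˢ toℕ k) (toℕ i)) * hᵢ i)
      ≈⟨ sum-cong-≋ {suc n} (λ i → *-distribʳ-sum {suc n} (hᵢ i) (λ k → f (toℕ k) * (g ^ˢ toℕ k) (toℕ i))) ⟩
    ∑[ i ≤ n ] ∑[ k ≤ n ] (f (toℕ k) * (g ^ˢ toℕ k) (toℕ i) * hᵢ i)
      ≈⟨ ∑-comm {suc n} {suc n} (λ i k → f (toℕ k) * (g ^ˢ toℕ k) (toℕ i) * hᵢ i) ⟩
    ∑[ k ≤ n ] ∑[ i ≤ n ] (f (toℕ k) * (g ^ˢ toℕ k) (toℕ i) * hᵢ i)
      ≈⟨ sum-cong-≋ {suc n} (λ k → *ˢ-scaleˡ (f (toℕ k)) (g ^ˢ toℕ k) h n) ⟩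
    ∑[ k ≤ n ] (f (toℕ k) * (g ^ˢ toℕ k *ˢ h) n) ∎
    where
    hᵢ : Fin (suc n) → Carrier
    hᵢ i = h (n ℕ.∸ toℕ i)
    extend : ∀ (i : Fin (suc n)) →
      substitute f g g₀≈0 (toℕ i) ≈ ∑[ k ≤ n ] (f (toℕ k) * (g ^ˢ toℕ k) (toℕ i))
    -- The bounds count terms: `suc (toℕ i)` grows to `suc n`, and an added index `k` satisfies
    -- `suc (toℕ i) ≤ k`, which is the hypothesis of `^ˢ-order`.
    extend i = sum-extend (λ k → f k * (g ^ˢ k) (toℕ i)) (Fin.toℕ<n i)
      (λ k i<k → trans (*-congˡ (^ˢ-order g₀≈0 k (toℕ i) i<k)) (zeroʳ _))

  -- Rising and falling factorials.

  ⟨⟩-cong : ∀ {a b} → a ≈ b → ∀ k → ⟨ a ⟩ k ≈ ⟨ b ⟩ k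
  ⟨⟩-cong a≈b zero    = refl
  ⟨⟩-cong a≈b (suc k) = *-cong (⟨⟩-cong a≈b k) (+-congʳ a≈b)

  ⟨1⟩≈! : ∀ k → ⟨ 1# ⟩ k ≈ (k !) × 1#
  ⟨1⟩≈! zero    = sym (+-identityʳ 1#)
  ⟨1⟩≈! (suc k) = begin
    -- The last factor `1# + k × 1#` is `suc k × 1#` by definition.
    ⟨ 1# ⟩ k * (suc k × 1#)      ≈⟨ *-congʳ (⟨1⟩≈! k) ⟩
    (k !) × 1# * (suc k × 1#)    ≈⟨ *-comm _ _ ⟩
    suc k × 1# * ((k !) × 1#)    ≈⟨ ×1-homo-* (suc k) (k !) ⟨
    (suc k !) × 1#               ∎

  -- The rising factorial supplies the factors `m + 1` to `m + k` that are absent from `m !`.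
  ⟨m+1⟩*m!≈[m+k]! : ∀ m k → ⟨ suc m × 1# ⟩ k * ((m !) × 1#) ≈ ((m ℕ.+ k) !) × 1#
  ⟨m+1⟩*m!≈[m+k]! m zero rewrite ℕ.+-identityʳ m = *-identityˡ _
  ⟨m+1⟩*m!≈[m+k]! m (suc k) rewrite ℕ.+-suc m k = begin
    r * (suc m × 1# + k × 1#) * ((m !) × 1#)
      ≈⟨ *-congʳ (*-congˡ (×-homo-+ 1# (suc m) k)) ⟨
    r * (suc (m ℕ.+ k) × 1#) * ((m !) × 1#)
      ≈⟨ solve 3 (λ a b c → (a ⊕ b) ⊕ c ⊜ b ⊕ (a ⊕ c)) refl r (suc (m ℕ.+ k) × 1#) ((m !) × 1#) ⟩
    suc (m ℕ.+ k) × 1# * (r * ((m !) × 1#))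
      ≈⟨ *-congˡ (⟨m+1⟩*m!≈[m+k]! m k) ⟩
    suc (m ℕ.+ k) × 1# * (((m ℕ.+ k) !) × 1#)
      ≈⟨ ×1-homo-* (suc (m ℕ.+ k)) ((m ℕ.+ k) !) ⟨
    (suc (m ℕ.+ k) !) × 1# ∎
    where
    r = ⟨ suc m × 1# ⟩ k

  -- After multiplication by `m !`, which characteristic zero allows to be cancelled, both sides
  -- become `(m + k) !`.
  ⟨1⟩*[m+k]Cm≈⟨m+1⟩ : ∀ m k → ⟨ 1# ⟩ k * (((m ℕ.+ k) C m) × 1#) ≈ ⟨ suc m × 1# ⟩ k
  ⟨1⟩*[m+k]Cm≈⟨m+1⟩ m k = *-cancelʳ-# (nonZero⇒#0 (m !) {{m ℕ.!≢0}}) (begin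
    ⟨ 1# ⟩ k * binom * m!     ≈⟨ *-congʳ (*-congʳ (⟨1⟩≈! k)) ⟩
    k! * binom * m!           ≈⟨ solve 3 (λ a b c → (a ⊕ b) ⊕ c ⊜ b ⊕ (c ⊕ a)) refl k! binom m! ⟩
    binom * (m! * k!)         ≈⟨ *-congˡ (×1-homo-* (m !) (k !)) ⟨
    binom * ((m ! ℕ.* k !) × 1#)
      ≈⟨ ×1-homo-* ((m ℕ.+ k) C m) (m ! ℕ.* k !) ⟨
    (((m ℕ.+ k) C m) ℕ.* (m ! ℕ.* k !)) × 1#
      ≡⟨ ≡.cong (_× 1#) ([m+k]Cm*[m!*k!]≡[m+k]! m k) ⟩
    ((m ℕ.+ k) !) × 1#        ≈⟨ ⟨m+1⟩*m!≈[m+k]! m k ⟨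
    ⟨ suc m × 1# ⟩ k * m!     ∎)
    where
    k!    = (k !) × 1#
    m!    = (m !) × 1#
    binom = ((m ℕ.+ k) C m) × 1#

  -- Propositional equality, rather than `≈`, lets the next proof rewrite with it.
  fromℤ[p+2] : ∀ p → -1ℤ ≤ℤ p → fromℤ (p ℤ.+ + 2) ≡ suc ∣ p ℤ.+ + 1 ∣ × 1#
  fromℤ[p+2] (+ q)        _ = ≡.cong (_× 1#) (ℕ.+-suc q 1)
  fromℤ[p+2] -[1+ zero ]  _ = ≡.refl
  fromℤ[p+2] -[1+ suc _ ] (-≤- ())

  ⟨1⟩*binomial≈⟨p+2⟩ : ∀ p → -1ℤ ≤ℤ p → ∀ k →
                       ⟨ 1# ⟩ k * binomial p k ≈ ⟨ fromℤ (p ℤ.+ + 2) ⟩ k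
  ⟨1⟩*binomial≈⟨p+2⟩ p -1≤p k
    rewrite ∣p+k+1∣≡∣p+1∣+k p -1≤p k | fromℤ[p+2] p -1≤p = ⟨1⟩*[m+k]Cm≈⟨m+1⟩ ∣ p ℤ.+ + 1 ∣ k

  -- The leading factor `1# - 0 × μ` is one, so `k` factors remain for the `k` powers of `lam`. Each
  -- pairs off as `(1 - (j+1)μ) λ = λ - (j+1) = -(1 - λ + j)`.
  falling*^≈⟨⟩ : ∀ lam μ → μ * lam ≈ 1# → ∀ k →
                 falling 1# (suc k) μ * lam ^ k ≈ ⟨ 1# - lam ⟩ k * (- 1#) ^ k
  falling*^≈⟨⟩ lam μ μλ≈1 zero    = *-congʳ (trans (*-identityˡ _) (x-0≈x 1#))
  falling*^≈⟨⟩ lam μ μλ≈1 (suc k) = begin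
    f * (1# - suc k × μ) * (lam * lam ^ k)
      ≈⟨ interchange f (1# - suc k × μ) lam (lam ^ k) ⟩
    f * lam ^ k * ((1# - suc k × μ) * lam)
      ≈⟨ *-cong (falling*^≈⟨⟩ lam μ μλ≈1 k) factor ⟩
    r * (- 1#) ^ k * ((1# - lam + k × 1#) * - 1#)
      ≈⟨ interchange r (1# - lam + k × 1#) (- 1#) ((- 1#) ^ k) ⟨
    r * (1# - lam + k × 1#) * (- 1# * (- 1#) ^ k) ∎
    where
    f = falling 1# (suc k) μ
    r = ⟨ 1# - lam ⟩ k
    interchange : ∀ a b c d → a * b * (c * d) ≈ a * d * (b * c)
    interchange = solve 4 (λ a b c d → (a ⊕ b) ⊕ (c ⊕ d) ⊜ (a ⊕ d) ⊕ (b ⊕ c)) refl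
    factor : (1# - suc k × μ) * lam ≈ (1# - lam + k × 1#) * - 1#
    factor = begin
      (1# - suc k × μ) * lam        ≈⟨ [y-z]x≈yx-zx lam 1# (suc k × μ) ⟩
      1# * lam - suc k × μ * lam    ≈⟨ +-cong (*-identityˡ lam) (-‿cong
                                         (trans (×-assoc-* (suc k) μ lam) (×-congʳ (suc k) μλ≈1))) ⟩
      lam - (1# + k × 1#)           ≈⟨ -‿anti-homo‿- (1# + k × 1#) lam ⟨
      - (1# + k × 1# - lam)         ≈⟨ -‿cong (xy∙z≈xz∙y 1# (k × 1#) (- lam)) ⟩
      - (1# - lam + k × 1#)         ≈⟨ -1*x≈-x _ ⟨
      - 1# * (1# - lam + k × 1#)    ≈⟨ *-comm _ _ ⟩
      (1# - lam + k × 1#) * - 1#    ∎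

  -- Comparison of the coefficients and summation over `k`.

  module _ (lam : Carrier) (lam#0 : lam # 0#) (p : ℤ) (-1≤p : -1ℤ ≤ℤ p) where

    coefficient : ℕ → Carrier
    coefficient k =
      falling 1# (suc k) (1# / lam [ lam#0 ]) * lam ^ k / binomial p k [ binomial#0 p -1≤p k ]

    hypergeometric : Series
    hypergeometric = ₂F₁ (1# - lam) 1# (fromℤ (p ℤ.+ + 2)) (⟨p+2⟩#0 p -1≤p)

    -- The sign joins `⟨ 1# - lam ⟩ k` to give the falling factorial, while the other two rising
    -- factorials form the reciprocal binomial. The factor `/! k` stays, since the definition of
    -- `S₂` absorbs it.
    hypergeometric≈coefficient : ∀ k → hypergeometric k * (- 1#) ^ k ≈ coefficient k /! k
    hypergeometric≈coefficient k = begin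
      a * b * c⁻¹ * k!⁻¹ * s
        ≈⟨ solve 5 (λ a b c d s → (((a ⊕ b) ⊕ c) ⊕ d) ⊕ s ⊜ ((a ⊕ s) ⊕ (b ⊕ c)) ⊕ d) refl a b c⁻¹ k!⁻¹ s ⟩
      a * s * (b * c⁻¹) * k!⁻¹
        ≈⟨ *-congʳ (*-cong (sym (falling*^≈⟨⟩ lam (1# / lam [ lam#0 ]) μλ≈1 k)) b/c≈1/binomial) ⟩
      f * (1# * binomial⁻¹) * k!⁻¹
        ≈⟨ *-congʳ (*-congˡ (*-identityˡ _)) ⟩
      f * binomial⁻¹ * k!⁻¹ ∎
      where
      a = ⟨ 1# - lam ⟩ k
      b = ⟨ 1# ⟩ k
      s = (- 1#) ^ k
      f = falling 1# (suc k) (1# / lam [ lam#0 ]) * lam ^ k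
      c⁻¹ = proj₁ (#⇒invertible (⟨p+2⟩#0 p -1≤p k))
      binomial⁻¹ = proj₁ (#⇒invertible (binomial#0 p -1≤p k))
      k!⁻¹ = proj₁ (#⇒invertible (nonZero⇒#0 (k !) {{k ℕ.!≢0}}))
      μλ≈1 : (1# / lam [ lam#0 ]) * lam ≈ 1#
      μλ≈1 = trans (*-congʳ (*-identityˡ _)) (trans (*-comm _ _) (*-inverseʳ lam#0))
      b/c≈1/binomial : b * c⁻¹ ≈ 1# * binomial⁻¹
      b/c≈1/binomial = cross-multiply (⟨p+2⟩#0 p -1≤p k) (binomial#0 p -1≤p k)
        (trans (⟨1⟩*binomial≈⟨p+2⟩ p -1≤p k) (sym (*-identityˡ _)))

    summand : ∀ x n k →
      ((n !) × 1#) * (hypergeometric k * ((1ˢ -ˢ e lam 1#) ^ˢ k *ˢ e lam x) n)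
        ≈ coefficient k * S₂ lam n k x
    summand x n k = begin
      n! * (hypergeometric k * ((1ˢ -ˢ e lam 1#) ^ˢ k *ˢ e lam x) n)
        ≈⟨ *-congˡ (*-congˡ (trans (*ˢ-congʳ (e lam x) (-ˢ-^ˢ 1ˢ (e lam 1#) k) n)
                                   (*ˢ-scaleˡ ((- 1#) ^ k) ((e lam 1# -ˢ 1ˢ) ^ˢ k) (e lam x) n))) ⟩
      n! * (hypergeometric k * ((- 1#) ^ k * P))
        ≈⟨ *-congˡ (*-assoc (hypergeometric k) ((- 1#) ^ k) P) ⟨
      n! * (hypergeometric k * (- 1#) ^ k * P)
        ≈⟨ *-congˡ (*-congʳ (hypergeometric≈coefficient k)) ⟩
      n! * (coefficient k * k!⁻¹ * P)
        ≈⟨ solve 4 (λ n c k p → n ⊕ ((c ⊕ k) ⊕ p) ⊜ c ⊕ (n ⊕ (p ⊕ k))) refl n! (coefficient k) k!⁻¹ P ⟩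
      -- The second factor is `S₂ lam n k x` unfolded: `n!` from `egfCoefficients` and `k!⁻¹` from
      -- `/! k`.
      coefficient k * (n! * (P * k!⁻¹)) ∎
      where
      n! = (n !) × 1#
      k!⁻¹ = proj₁ (#⇒invertible (nonZero⇒#0 (k !) {{k ℕ.!≢0}}))
      P = ((e lam 1# -ˢ 1ˢ) ^ˢ k *ˢ e lam x) n

    β≈∑ : ∀ x n → β p -1≤p lam n x ≈ ∑[ k ≤ n ] (coefficient (toℕ k) * S₂ lam n (toℕ k) x)
    β≈∑ x n = begin
      n! * (substitute hypergeometric g (1-e-constant lam 1#) *ˢ e lam x) n
        ≈⟨ *-congˡ (substitute-*ˢ hypergeometric g (1-e-constant lam 1#) (e lam x) n) ⟩
      n! * ∑[ k ≤ n ] (hypergeometric (toℕ k) * (g ^ˢ toℕ k *ˢ e lam x) n)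
        ≈⟨ *-distribˡ-sum {suc n} n! (λ k → hypergeometric (toℕ k) * (g ^ˢ toℕ k *ˢ e lam x) n) ⟩
      ∑[ k ≤ n ] (n! * (hypergeometric (toℕ k) * (g ^ˢ toℕ k *ˢ e lam x) n))
        ≈⟨ sum-cong-≋ {suc n} (λ k → summand x n (toℕ k)) ⟩
      ∑[ k ≤ n ] (coefficient (toℕ k) * S₂ lam n (toℕ k) x) ∎
      where
      n! = (n !) × 1#
      g  = 1ˢ -ˢ e lam 1#

theorem10 :
  ∀ {c ℓ₁ ℓ₂} (F : HeytingField c ℓ₁ ℓ₂) (char0 : CharacteristicZero F) →
  let open HeytingField F
      open Degenerate F char0
  in (lam : Carrier) (lam#0 : lam # 0#) (p : ℤ) (-1≤p : -1ℤ ≤ℤ p) (x : Carrier) (n : ℕ) →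
     β p -1≤p lam n x
       ≈ ∑[ k ≤ n ]
           ( falling 1# (suc (toℕ k)) (1# / lam [ lam#0 ]) * lam ^ toℕ k
               / binomial p (toℕ k) [ binomial#0 p -1≤p (toℕ k) ]
             * S₂ lam n (toℕ k) x )
theorem10 F char0 lam lam#0 p -1≤p x n = β≈∑ F char0 lam lam#0 p -1≤p x n
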